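{- Consider MALIQUANT. Then, $\mathcal{SG}(0)=0$ and, for all $n\in \mathbb{N}$, $\mathcal{SG}(n)=i_o(n)$.
   Context: MALIQUANT is the impartial normal-play game on the nonnegative integers where from $n$ a player moves to a nondivisor of $n$ smaller than $n$: $\mathrm{opt}(n)=\{d: 0\le d<n,\ d\nmid n\}$ (in particular $0$ is an option of every $n>0$, and $0$ has no options). $\mathcal{SG}$ denotes the Sprague-Grundy value (mex rule). $i_o:\mathbb{N}\to\mathbb{N}$ is the index of the largest odd factor: if $n=2^k(2m-1)$ then $i_o(n)=m$. -}

module Defs where

open import Data.Fin.Base using (Fin; toℕ; fromℕ<)
open import Data.Fin.Properties using (¬∀⟶∃¬-smallest; pigeonhole; toℕ-injective; toℕ-fromℕ<; toℕ-inject; <⇒≢)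
open import Data.List.Base using (List; length; lookup; map; filter; upTo)
open import Data.List.Membership.DecPropositional using () renaming (_∈?_ to memberDec)
open import Data.List.Membership.Propositional using (_∈_; _∉_; mapWith∈)
open import Data.List.Membership.Propositional.Properties using (∈-upTo⁺; ∈-upTo⁻; ∈-filter⁺; ∈-filter⁻; mapWith∈-cong; mapWith∈≗map)
open import Data.List.Relation.Unary.Any using (index)
open import Data.List.Relation.Unary.Any.Properties using (lookup-index)
open import Data.Nat.Base using (ℕ; zero; suc; _+_; _*_; _∸_; _^_; _<_; _>_; z<s; NonZero; >-nonZero⁻¹)
open import Data.Nat.Divisibility using (_∤_; _∣?_)
open import Data.Nat.Induction using (<-rec; <-wellFounded)
open import Data.Nat.Properties using (_≟_; +-suc; *-assoc; *-identityˡ; *-cancelˡ-≡; suc-injective; even≢odd; n<1+n; m<m+n)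
open import Data.Product.Base using (∃; _×_; _,_; proj₁; proj₂)
open import Data.Sum.Base using (_⊎_; inj₁; inj₂)
open import Induction.WellFounded using (module FixPoint)
open import Relation.Binary.PropositionalEquality using (_≡_; refl; sym; trans; cong; subst)
open import Relation.Nullary using (¬_; ¬?; contradiction)

record IsMex (xs : List ℕ) (m : ℕ) : Set where
  field
    excluded : m ∉ xs
    minimal  : ∀ {k} → k < m → k ∈ xs

-- The search is bounded: by the pigeonhole principle xs cannot contain all
-- of 0 , … , length xs.
mexWithProof : (xs : List ℕ) → ∃ (IsMex xs)
mexWithProof xs = toℕ i , record
  { excluded = i∉xs
  ; minimal  = λ k<i → subst (_∈ xs)
                 (trans (toℕ-inject (fromℕ< k<i)) (toℕ-fromℕ< k<i))
                 (below (fromℕ< k<i))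
  }
  where
  notAll : ¬ (∀ (i : Fin (suc (length xs))) → toℕ i ∈ xs)
  notAll all with pigeonhole (n<1+n (length xs)) (λ i → index (all i))
  ... | i , j , i<j , eq = <⇒≢ i<j (toℕ-injective
    (trans (lookup-index (all i))
      (trans (cong (lookup xs) eq) (sym (lookup-index (all j))))))

  search = ¬∀⟶∃¬-smallest (suc (length xs)) (λ i → toℕ i ∈ xs)
             (λ i → memberDec _≟_ (toℕ i) xs) notAll
  i     = proj₁ search
  i∉xs  = proj₁ (proj₂ search)
  below = proj₂ (proj₂ search)

mex : List ℕ → ℕ
mex xs = proj₁ (mexWithProof xs)

mex-isMex : ∀ xs → IsMex xs (mex xs)
mex-isMex xs = proj₂ (mexWithProof xs)

module SpragueGrundy
  (opt   : ℕ → List ℕ)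
  (opt-< : ∀ {n d} → d ∈ opt n → d < n)
  where

  private
    step : ∀ n → (∀ {d} → d < n → ℕ) → ℕ
    step n rec = mex (mapWith∈ (opt n) (λ d∈ → rec (opt-< d∈)))

    step-ext : ∀ n {r r′ : ∀ {d} → d < n → ℕ} →
               (∀ {d} (d<n : d < n) → r d<n ≡ r′ d<n) → step n r ≡ step n r′
    step-ext n eq = cong mex (mapWith∈-cong (opt n) _ _ (λ d∈ → eq (opt-< d∈)))

  grundy : ℕ → ℕ
  grundy = <-rec (λ _ → ℕ) step

  grundy-mex : ∀ n → grundy n ≡ mex (map grundy (opt n))
  grundy-mex n = trans
    (FixPoint.unfold-wfRec <-wellFounded (λ _ → ℕ) step step-ext {n})
    (cong mex (mapWith∈≗map grundy (opt n)))

-- In the library 0 ∣ n holds only for n ≡ 0, so 0 is an option of every n > 0.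
opt : ℕ → List ℕ
opt n = filter (λ d → ¬? (d ∣? n)) (upTo n)

∈-opt⁺ : ∀ {n d} → d < n → d ∤ n → d ∈ opt n
∈-opt⁺ {n} d<n d∤n = ∈-filter⁺ (λ d → ¬? (d ∣? n)) (∈-upTo⁺ d<n) d∤n

∈-opt⁻ : ∀ {n d} → d ∈ opt n → d < n × d ∤ n
∈-opt⁻ {n} d∈ with ∈-filter⁻ (λ d → ¬? (d ∣? n)) {xs = upTo n} d∈
... | d∈upTo , d∤n = ∈-upTo⁻ d∈upTo , d∤n

open SpragueGrundy opt (λ d∈ → proj₁ (∈-opt⁻ d∈)) public
  renaming (grundy to SG; grundy-mex to SG-mex)

record OddDecomposition (n : ℕ) : Set where
  field
    k m   : ℕ
    m>0   : m > 0
    n≡    : n ≡ 2 ^ k * (2 * m ∸ 1)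

private
  2*suc∸1 : ∀ m → 2 * suc m ∸ 1 ≡ suc (2 * m)
  2*suc∸1 m = +-suc m (m + 0)

  half : ∀ n → ∃ λ h → n ≡ 2 * h ⊎ n ≡ suc (2 * h)
  half zero = 0 , inj₁ refl
  half (suc n) with half n
  ... | h , inj₁ refl = h , inj₂ refl
  ... | h , inj₂ refl = suc h , inj₁ (cong suc (sym (2*suc∸1 h)))

oddDecomposition : ∀ n → n > 0 → OddDecomposition n
oddDecomposition = <-rec (λ n → n > 0 → OddDecomposition n) go
  where
  go : ∀ n → (∀ {h} → h < n → h > 0 → OddDecomposition h) →
       n > 0 → OddDecomposition n
  go n rec n>0 with half n
  go _ rec _  | h , inj₂ refl = record
    { k = 0 ; m = suc h ; m>0 = z<s
    ; n≡ = sym (trans (*-identityˡ _) (2*suc∸1 h)) }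
  go _ rec () | zero , inj₁ refl
  go _ rec _  | suc h , inj₁ refl = record
    { k = suc k ; m = m ; m>0 = m>0
    ; n≡ = trans (cong (2 *_) n≡) (sym (*-assoc 2 (2 ^ k) (2 * m ∸ 1))) }
    where open OddDecomposition (rec (m<m+n (suc h) z<s) z<s)

iₒ : (n : ℕ) → .{{NonZero n}} → ℕ
iₒ n = OddDecomposition.m (oddDecomposition n (>-nonZero⁻¹ n))

private
  unique : ∀ k l a b → 2 ^ k * (2 * suc a ∸ 1) ≡ 2 ^ l * (2 * suc b ∸ 1) → a ≡ b
  unique zero zero a b eq
    rewrite *-identityˡ (2 * suc a ∸ 1) | *-identityˡ (2 * suc b ∸ 1)
          | 2*suc∸1 a | 2*suc∸1 b = *-cancelˡ-≡ a b 2 (suc-injective eq)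
  unique zero (suc l) a b eq
    rewrite *-identityˡ (2 * suc a ∸ 1) | 2*suc∸1 a
          | *-assoc 2 (2 ^ l) (2 * suc b ∸ 1)
    = contradiction (sym eq) (even≢odd (2 ^ l * (2 * suc b ∸ 1)) a)
  unique (suc k) zero a b eq
    rewrite *-identityˡ (2 * suc b ∸ 1) | 2*suc∸1 b
          | *-assoc 2 (2 ^ k) (2 * suc a ∸ 1)
    = contradiction eq (even≢odd (2 ^ k * (2 * suc a ∸ 1)) b)
  unique (suc k) (suc l) a b eq
    rewrite *-assoc 2 (2 ^ k) (2 * suc a ∸ 1) | *-assoc 2 (2 ^ l) (2 * suc b ∸ 1)
    = unique k l a b (*-cancelˡ-≡ _ _ 2 eq)

iₒ-unique : ∀ n .{{_ : NonZero n}} k m → m > 0 → n ≡ 2 ^ k * (2 * m ∸ 1) → iₒ n ≡ m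
iₒ-unique n k (suc m) _ eq with oddDecomposition n (>-nonZero⁻¹ n)
... | record { k = l ; m = suc m′ ; n≡ = eq′ } =
  cong suc (unique l k m′ m (trans (sym eq′) eq))

{-# OPTIONS --safe #-}

-- Let n = 2^k (2m − 1).  A smaller number with odd index m is 2^l (2m − 1) with
-- l < k, a divisor of n, so m is not the value of an option.  For 0 < j < m put
-- d = 2^k (2j − 1) < n.  Then 2d does not divide n, having one factor 2 too many.
-- If 2d < n, then 2d is an option with odd index j.  Otherwise d < n < 2d, so d
-- does not divide n and is itself such an option.
module Submission where

open import Defs
open import Data.List.Base using (map)
open import Data.List.Membership.Propositional using (_∈_; _∉_)
open import Data.List.Membership.Propositional.Properties using (∈-map⁺; ∈-map⁻)
open import Data.Nat.Base using (ℕ; zero; suc; _+_; _*_; _∸_; _^_; _≤_; _<_; _>_; z<s; z≤n; s≤s; NonZero; >-nonZero⁻¹)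
open import Data.Nat.Divisibility using (_∣_; _∤_; divides; ∣-reflexive; *-monoˡ-∣; *-cancelˡ-∣; 0∣⇒≡0; m∣m*n)
open import Data.Nat.Induction using (<-rec)
open import Data.Nat.Properties
open import Data.Product.Base using (∃; _×_; _,_)
open import Data.Sum.Base using (inj₁; inj₂)
open import Relation.Binary.Definitions using (tri<; tri≈; tri>)
open import Relation.Binary.PropositionalEquality using (_≡_; _≢_; refl; sym; trans; cong; subst; module ≡-Reasoning)
open import Relation.Nullary using (yes; no; contradiction)

IsMex-unique : ∀ {xs m n} → IsMex xs m → IsMex xs n → m ≡ n
IsMex-unique {m = m} {n} p q with <-cmp m n
... | tri< m<n _ _ = contradiction (IsMex.minimal q m<n) (IsMex.excluded p)
... | tri≈ _ m≡n _ = m≡n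
... | tri> _ _ n<m = contradiction (IsMex.minimal p n<m) (IsMex.excluded q)

^-monoʳ-∣ : ∀ m {k l} → k ≤ l → m ^ k ∣ m ^ l
^-monoʳ-∣ m {k} {l} k≤l = subst (m ^ k ∣_)
  (trans (sym (^-distribˡ-+-* m k (l ∸ k))) (cong (m ^_) (m+[n∸m]≡n k≤l)))
  (m∣m*n (m ^ (l ∸ k)))

-- The exponents are comparable, and `l ≤ k` would reverse the strict inequality.
^*-<⇒∣ : ∀ m .{{_ : NonZero m}} k l c → m ^ k * c < m ^ l * c → m ^ k * c ∣ m ^ l * c
^*-<⇒∣ m k l c lt with ≤-total k l
... | inj₁ k≤l = *-monoˡ-∣ c (^-monoʳ-∣ m k≤l)
... | inj₂ l≤k = contradiction (*-monoˡ-≤ c (^-monoʳ-≤ m l≤k)) (<⇒≱ lt)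

-- The quotient of a proper divisor is neither 0 nor 1.
∣∧<⇒2*≤ : ∀ {d n} → d ∣ n → d < n → 2 * d ≤ n
∣∧<⇒2*≤ (divides zero refl) ()
∣∧<⇒2*≤ {d} (divides (suc zero) refl) d<n =
  contradiction (≤-reflexive (*-identityˡ d)) (<⇒≱ d<n)
∣∧<⇒2*≤ {d} (divides (suc (suc q)) refl) _ = *-monoˡ-≤ d (s≤s (s≤s (z≤n {q})))

2*∤odd : ∀ a {m} → m > 0 → 2 * a ∤ 2 * m ∸ 1
2*∤odd a {suc m} _ (divides q eq) = even≢odd (q * a) m (begin
  2 * (q * a)     ≡⟨ sym (*-assoc 2 q a) ⟩
  2 * q * a       ≡⟨ cong (_* a) (*-comm 2 q) ⟩
  q * 2 * a       ≡⟨ *-assoc q 2 a ⟩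
  q * (2 * a)     ≡⟨ sym eq ⟩
  2 * suc m ∸ 1   ≡⟨ +-suc m (m + 0) ⟩
  suc (2 * m)     ∎)
  where open ≡-Reasoning

2*[2^k*a]∤2^k*odd : ∀ k a {m} → m > 0 → 2 * (2 ^ k * a) ∤ 2 ^ k * (2 * m ∸ 1)
2*[2^k*a]∤2^k*odd k a {m} m>0 2d∣n = 2*∤odd a m>0
  (*-cancelˡ-∣ (2 ^ k) {{m^n≢0 2 k}} (subst (_∣ 2 ^ k * (2 * m ∸ 1)) swap 2d∣n))
  where
  swap : 2 * (2 ^ k * a) ≡ 2 ^ k * (2 * a)
  swap = trans (sym (*-assoc 2 (2 ^ k) a))
    (trans (cong (_* a) (*-comm 2 (2 ^ k))) (*-assoc (2 ^ k) 2 a))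

option-with-oddIndex : ∀ k {m j} → 0 < j → j < m →
  ∃ λ l → 2 ^ l * (2 * j ∸ 1) ∈ opt (2 ^ k * (2 * m ∸ 1))
option-with-oddIndex k {m} {j} 0<j j<m = choose (2 * d <? n)
  where
  d = 2 ^ k * (2 * j ∸ 1)
  n = 2 ^ k * (2 * m ∸ 1)

  d<n : d < n
  -- Truncated `∸ 1` stays strictly monotone here because `0 < j` gives `1 ≤ 2 * j`.
  d<n = *-monoʳ-< (2 ^ k) {{m^n≢0 2 k}}
    (∸-monoˡ-< (*-monoʳ-< 2 j<m) (≤-trans 0<j (m≤m+n j (j + 0))))

  2d∤n : 2 * d ∤ n
  2d∤n = 2*[2^k*a]∤2^k*odd k (2 * j ∸ 1) (≤-<-trans z≤n j<m)

  choose : _ → ∃ λ l → 2 ^ l * (2 * j ∸ 1) ∈ opt n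
  choose (yes 2d<n) = suc k , subst (_∈ opt n) (sym (*-assoc 2 (2 ^ k) (2 * j ∸ 1))) (∈-opt⁺ 2d<n 2d∤n)
  -- If `d` divided `n`, then `2 * d ≤ n ≤ 2 * d`, and this equality contradicts `2d∤n`.
  choose (no 2d≮n) = k , ∈-opt⁺ d<n λ d∣n →
    2d∤n (∣-reflexive (≤-antisym (∣∧<⇒2*≤ d∣n d<n) (≮⇒≥ 2d≮n)))

-- g stands for SG, kept abstract so that it does not unfold in conversion checking.
module _ (g : ℕ → ℕ) (g-mex : ∀ n → g n ≡ mex (map g (opt n))) where

  grundy-0 : g 0 ≡ 0
  -- `opt 0` evaluates to the empty list, whose `mex` evaluates to 0.
  grundy-0 = g-mex 0

  -- Quantifying over every decomposition lets the induction hypothesis serve both the computed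
  -- decomposition of an arbitrary option and the explicit one of a constructed option.
  grundy-2^k*odd : ∀ n k m → m > 0 → n ≡ 2 ^ k * (2 * m ∸ 1) → g n ≡ m
  grundy-2^k*odd = <-rec _ go
    where
    go : ∀ n → (∀ {d} → d < n → ∀ l j → j > 0 → d ≡ 2 ^ l * (2 * j ∸ 1) → g d ≡ j) →
         ∀ k m → m > 0 → n ≡ 2 ^ k * (2 * m ∸ 1) → g n ≡ m
    go n rec k m m>0 refl = trans (g-mex n)
      (IsMex-unique (mex-isMex _) (record { excluded = excluded ; minimal = minimal }))
      where
      value≢m : ∀ d → d < n → d ∤ n → g d ≢ m
      value≢m zero    _   _   g0≡m = <⇒≢ m>0 (trans (sym grundy-0) g0≡m)
      value≢m (suc d) d<n d∤n gd≡m with oddDecomposition (suc d) z<s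
      ... | record { k = l ; m = j ; m>0 = j>0 ; n≡ = d≡ }
        -- By induction the option has value `j`, so `j` is identified with `m` and both numbers
        -- share their odd part.
        with refl ← trans (sym gd≡m) (rec d<n l j j>0 d≡) =
        d∤n (subst (_∣ n) (sym d≡) (^*-<⇒∣ 2 l k (2 * m ∸ 1) (subst (_< n) d≡ d<n)))

      excluded : m ∉ map g (opt n)
      excluded m∈ with ∈-map⁻ g m∈
      ... | d , d∈ , m≡gd with ∈-opt⁻ d∈
      ... | d<n , d∤n = value≢m d d<n d∤n (sym m≡gd)

      n>0 : n > 0
      -- The left side `0` is read as `0 * 0`, and its second factor as `1 ∸ 1`.
      n>0 = *-mono-< (m^n>0 2 k) (∸-monoˡ-< (*-monoʳ-≤ 2 m>0) (s≤s z≤n))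

      minimal : ∀ {j} → j < m → j ∈ map g (opt n)
      -- The value 0 is attained at the option 0, which has no odd index.
      minimal {zero} _ = subst (_∈ map g (opt n)) grundy-0
        (∈-map⁺ g (∈-opt⁺ n>0 λ 0∣n → >⇒≢ n>0 (0∣⇒≡0 0∣n)))
      minimal {suc j} j<m with option-with-oddIndex k z<s j<m
      ... | l , d∈ with ∈-opt⁻ d∈
      ... | d<n , _ = subst (_∈ map g (opt n)) (rec d<n l (suc j) z<s refl) (∈-map⁺ g d∈)

mainTheorem4 : SG 0 ≡ 0 × ((n : ℕ) → .{{_ : NonZero n}} → SG n ≡ iₒ n)
mainTheorem4 = grundy-0 SG SG-mex , λ n → let open OddDecomposition (oddDecomposition n (>-nonZero⁻¹ n))
                            in grundy-2^k*odd SG SG-mex n k m m>0 n≡
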